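{- Let $n\ge 2$, let $G$ be a (not necessarily commutative) group of order $4n^2$, written additively, and let $D\subseteq G$ be a Hadamard difference set, i.e. a $(4n^2,2n^2-n,n^2-n)$ difference set in $G$. Then $D^2\cup(\overline{D})^{2}\subseteq G^2$ is a difference set of propriety $3$ with parameters $$\big(4n^2,\ 2n^2(4n^2+1),\ 2n^2(2n^2+1)\big).$$ Moreover, $D^{2- }\cup(\overline{D})^{2- }$ and $(D\times\overline{D})\cup(\overline{D}\times D)$ are difference sets of propriety $3$ with parameters $$\big(4n^2,\ 2n^2(4n^2-1),\ 2n^2(2n^2-1)\big).$$
   Context: A $(v,k,\lambda)$ difference set in a group $G$ of order $v$ is a subset $D\subseteq G$ with $|D|=k$ such that for every $g\in G\setminus\{0\}$ there are exactly $\lambda$ choices of $x,x'\in D$ with $x-x'=g$. Notation: $\overline{D}=G\setminus D$, and for $E\subseteq G$, $E^2=E\times E$ and $E^{2- }=(E\times E)\setminus\{(x,x)\mid x\in E\}$. A set $P\subseteq G^2$ with $|P|=K$ is a $(v,K,\Lambda)$ difference set of propriety $3$ if for every $g\in G\setminus\{0\}$: 1. there are exactly $\Lambda$ choices of $(x,y),(x',y')\in P$ with $-x+x'=-y+y'=g$; 2. there are exactly $\Lambda$ choices of $(x,y),(x',y')\in P$ with $x-x'=g$ and $y=y'$; 3. there are exactly $\Lambda$ choices of $(x,y),(x',y')\in P$ with $x=x'$ and $y-y'=g$. -}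

module Defs where

open import Level using (Level; _⊔_)
open import Algebra.Bundles using (Group)
open import Data.Fin.Base using (Fin)
open import Data.Nat.Base using (ℕ; _*_; _^_; _∸_)
open import Data.Product.Base using (_×_; _,_; proj₁)
open import Data.Product.Relation.Binary.Pointwise.NonDependent using (_×ₛ_)
open import Function.Bundles using (Inverse)
open import Relation.Binary.Bundles using (Setoid)
open import Relation.Binary.Definitions using (_Respects_)
import Relation.Binary.Construct.On as On
import Relation.Binary.PropositionalEquality.Properties as ≡
open import Relation.Nullary.Negation.Core using (¬_)
open import Relation.Unary using (Pred; _∈_; _∖_; _⟨×⟩_)

private
  variable
    a c ℓ p : Level

-- Elements are counted up to the setoid equality.
HasCardinality : Setoid a ℓ → ℕ → Set (a ⊔ ℓ)
HasCardinality S n = Inverse (≡.setoid (Fin n)) S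

-- Equality compares the underlying elements only; membership proofs are
-- irrelevant, so overlapping disjuncts in a union are not counted twice.
subsetoid : (S : Setoid a ℓ) → Pred (Setoid.Carrier S) p → Setoid (a ⊔ p) ℓ
subsetoid S P = On.setoid S (proj₁ {B = P})

infix 8 _²

_² : {A : Set a} → Pred A p → Pred (A × A) p
E ² = E ⟨×⟩ E

module _ (G : Group c ℓ) where

  open Group G
    using (Carrier; _≈_; setoid)
    renaming (_∙_ to infixl 6 _+_; ε to 0#; _⁻¹ to infix 8 -_)

  diagonal : Pred Carrier p → Pred (Carrier × Carrier) (p ⊔ ℓ)
  diagonal E (x , y) = x ∈ E × x ≈ y

  offDiagonalSquare : Pred Carrier p → Pred (Carrier × Carrier) (p ⊔ ℓ)
  offDiagonalSquare E = E ² ∖ diagonal E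

  -- The group is written additively but is not assumed commutative.
  -- D is a subset of G up to ≈, hence the field respects.
  record IsDifferenceSet (v k λ′ : ℕ) (D : Pred Carrier p) : Set (c ⊔ ℓ ⊔ p) where
    field
      order       : HasCardinality setoid v
      respects    : D Respects _≈_
      size        : HasCardinality (subsetoid setoid D) k
      differences : ∀ g → ¬ (g ≈ 0#) →
        HasCardinality
          (subsetoid (setoid ×ₛ setoid)
            λ (x , x′) → x ∈ D × x′ ∈ D × x + - x′ ≈ g)
          λ′

  record IsDifferenceSetOfPropriety3
      (v K Λ : ℕ) (P : Pred (Carrier × Carrier) p) : Set (c ⊔ ℓ ⊔ p) where
    private
      G² : Setoid c ℓ
      G² = setoid ×ₛ setoid
    field
      order    : HasCardinality setoid v
      respects : P Respects (Setoid._≈_ G²)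
      size     : HasCardinality (subsetoid G² P) K
      differences₁ : ∀ g → ¬ (g ≈ 0#) →
        HasCardinality
          (subsetoid (G² ×ₛ G²)
            λ ((x , y) , (x′ , y′)) → (x , y) ∈ P × (x′ , y′) ∈ P ×
              - x + x′ ≈ - y + y′ × - y + y′ ≈ g)
          Λ
      differences₂ : ∀ g → ¬ (g ≈ 0#) →
        HasCardinality
          (subsetoid (G² ×ₛ G²)
            λ ((x , y) , (x′ , y′)) → (x , y) ∈ P × (x′ , y′) ∈ P ×
              x + - x′ ≈ g × y ≈ y′)
          Λ
      differences₃ : ∀ g → ¬ (g ≈ 0#) →
        HasCardinality
          (subsetoid (G² ×ₛ G²)
            λ ((x , y) , (x′ , y′)) → (x , y) ∈ P × (x′ , y′) ∈ P ×
              x ≈ x′ × y + - y′ ≈ g)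
          Λ

  IsHadamardDifferenceSet : ℕ → Pred Carrier p → Set (c ⊔ ℓ ⊔ p)
  IsHadamardDifferenceSet n = IsDifferenceSet (4 * n ^ 2) (2 * n ^ 2 ∸ n) (n ^ 2 ∸ n)

{-# OPTIONS --safe #-}
module Submission where

-- Let f = ±1 be the sign of membership in D, v = |G| and S = Σ f. The parameters say S² = v and
-- Σₓ f(g + x) f(x) = 0 for g ≠ 0. The same holds with x + g in place of g + x: the two
-- autocorrelations have equal sums of squares over g, and both equal v at g = 0, so the second
-- one vanishes elsewhere too. Each of the three sets P satisfies
--   2 [(x , y) ∈ P] = 1 + s f(x) f(y) + c [x = y]   with c (c + 2 s) = 0,
-- for (s , c) = (1 , 0), (1 , -2), (-1 , 0) respectively. Summing this weight over G², and products
-- of two translates of it, gives 2 K = v² + (s + c) v and 4 Λ = v² + 2 (s + c) v.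

open import Algebra.Bundles using (Group)
open import Data.Nat.Base using (ℕ; _+_; _*_; _∸_; _^_; _≤_)
open import Data.Product.Base using (_×_)
open import Relation.Unary using (Pred; ∁; _∪_; _⟨×⟩_)
open import Defs

open import Level using (Level)
open import Data.Fin.Base using (Fin; zero; suc; combine; _↑ˡ_; _↑ʳ_)
open import Data.Fin.Permutation using (↔⇒≡)
import Data.Fin.Properties as Fin
open import Data.Integer.Base as ℤ using (ℤ; +_; -[1+_]; -_; 0ℤ; 1ℤ)
  renaming (_+_ to _+ᶻ_; _*_ to _*ᶻ_)
import Data.Integer.Properties as ℤ
open import Data.Integer.Tactic.RingSolver using (solve-∀)
open import Data.Nat.Base as ℕ using (zero; suc; z≤n; s≤s)
import Data.Nat.Properties as ℕ
import Data.Sum.Base as Sum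
open import Data.Product.Base using (Σ-syntax; _,_; proj₁; proj₂)
open import Data.Product.Function.NonDependent.Setoid using (_×-inverse_)
open import Data.Product.Relation.Binary.Pointwise.NonDependent
  using (_×ₛ_; Pointwise-≡↔≡)
open import Data.Sum.Base using (inj₁; inj₂)
open import Function.Base using (_∘_; id)
open import Function.Bundles using (Inverse)
open import Function.Definitions using (Congruent)
open import Function.Properties.Inverse using ()
  renaming (sym to ↔-sym; trans to ↔-trans)
open import Relation.Binary.Bundles using (Setoid)
open import Relation.Binary.Definitions using (_Respects_) renaming (Decidable to Decidable₂)
open import Relation.Binary.PropositionalEquality
  using (_≡_; refl; sym; trans; cong; cong₂; subst; module ≡-Reasoning)
import Relation.Binary.PropositionalEquality.Properties as ≡
open import Relation.Nullary.Decidable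
  using (Dec; yes; no; map′; _×-dec_; _⊎-dec_; ¬?)
open import Relation.Nullary.Negation using (¬_; contradiction)
open import Relation.Unary using (Decidable; _∈_)

open import Algebra.Bundles using (module CommutativeRing)
open import Algebra.Properties.Semiring.Sum
  (CommutativeRing.semiring ℤ.+-*-commutativeRing)
  using (sum; sum-cong-≗; sum-permute; ∑-distrib-+; ∑-comm; *-distribˡ-sum; *-distribʳ-sum)

private
  variable
    a b ℓ ℓ′ p q : Level

-- Indicators of decidable propositions and finite sums of integers.

χ : {A : Set a} → Dec A → ℤ
χ (yes _) = 1ℤ
χ (no  _) = 0ℤ

χ-cong : {A : Set a} {B : Set b} (a? : Dec A) (b? : Dec B) →
         (A → B) → (B → A) → χ a? ≡ χ b?
χ-cong (yes _) (yes _) _ _ = refl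
χ-cong (no  _) (no  _) _ _ = refl
χ-cong (yes x) (no ¬y) f _ = contradiction (f x) ¬y
χ-cong (no ¬x) (yes y) _ g = contradiction (g y) ¬x

χ-no : {A : Set a} (a? : Dec A) → ¬ A → χ a? ≡ 0ℤ
χ-no (yes x) ¬x = contradiction x ¬x
χ-no (no  _) _  = refl

χ-yes : {A : Set a} (a? : Dec A) → A → χ a? ≡ 1ℤ
χ-yes (yes _) _ = refl
χ-yes (no ¬x) x = contradiction x ¬x

χ-× : {A : Set a} {B : Set b} (a? : Dec A) (b? : Dec B) →
      χ (a? ×-dec b?) ≡ χ a? *ᶻ χ b?
χ-× (yes _) (yes _) = refl
χ-× (yes _) (no  _) = refl
χ-× (no  _) (yes _) = refl
χ-× (no  _) (no  _) = refl

0≤i*i : ∀ i → 0ℤ ℤ.≤ i *ᶻ i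
0≤i*i (+ n)    = subst (0ℤ ℤ.≤_) (ℤ.pos-* n n) (ℤ.+≤+ z≤n)
0≤i*i -[1+ n ] = ℤ.+≤+ z≤n

i*i≡0⇒i≡0 : ∀ i → i *ᶻ i ≡ 0ℤ → i ≡ 0ℤ
i*i≡0⇒i≡0 i eq with ℤ.i*j≡0⇒i≡0∨j≡0 i eq
... | inj₁ i≡0 = i≡0
... | inj₂ i≡0 = i≡0

0≤sum : ∀ {n} (h : Fin n → ℤ) → (∀ i → 0ℤ ℤ.≤ h i) → 0ℤ ℤ.≤ sum h
0≤sum {zero}  h 0≤h = ℤ.≤-refl
0≤sum {suc n} h 0≤h = ℤ.+-mono-≤ (0≤h zero) (0≤sum (h ∘ suc) (0≤h ∘ suc))

nonNeg-+≡0 : ∀ {i j} → 0ℤ ℤ.≤ i → 0ℤ ℤ.≤ j → i +ᶻ j ≡ 0ℤ → i ≡ 0ℤ × j ≡ 0ℤ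
nonNeg-+≡0 {+ m} {+ n} (ℤ.+≤+ _) (ℤ.+≤+ _) eq =
  cong +_ (ℕ.m+n≡0⇒m≡0 m (ℤ.+-injective eq)) ,
  cong +_ (ℕ.m+n≡0⇒n≡0 m (ℤ.+-injective eq))

nonNeg-sum≡0 : ∀ {n} (h : Fin n → ℤ) → (∀ i → 0ℤ ℤ.≤ h i) → sum h ≡ 0ℤ →
               ∀ i → h i ≡ 0ℤ
nonNeg-sum≡0 {suc n} h 0≤h eq i
  with nonNeg-+≡0 (0≤h zero) (0≤sum (h ∘ suc) (0≤h ∘ suc)) eq
nonNeg-sum≡0 h 0≤h eq zero    | h₀≡0 , _ = h₀≡0
nonNeg-sum≡0 h 0≤h eq (suc i) | _ , hₛ≡0 = nonNeg-sum≡0 (h ∘ suc) (0≤h ∘ suc) hₛ≡0 i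

sum-++ : ∀ m {n} (h : Fin (m ℕ.+ n) → ℤ) →
         sum h ≡ sum (λ i → h (i ↑ˡ n)) +ᶻ sum (λ j → h (m ↑ʳ j))
sum-++ zero    h = sym (ℤ.+-identityˡ _)
sum-++ (suc m) h =
  trans (cong (h zero +ᶻ_) (sum-++ m (h ∘ suc))) (sym (ℤ.+-assoc (h zero) _ _))

sum-combine : ∀ m {n} (h : Fin (m ℕ.* n) → ℤ) →
              sum h ≡ sum (λ i → sum (λ j → h (combine {m} {n} i j)))
sum-combine zero        h = refl
sum-combine (suc m) {n} h =
  trans (sum-++ n h) (cong (sum (λ j → h (j ↑ˡ (m ℕ.* n))) +ᶻ_) (sum-combine m (h ∘ (n ↑ʳ_))))

-- Cardinalities of setoids and of their subsets.

cardinality-unique : {S : Setoid a ℓ} {m n : ℕ} →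
                     HasCardinality S m → HasCardinality S n → m ≡ n
cardinality-unique F F′ = ↔⇒≡ (↔-trans F (↔-sym F′))

-- Equality in a subsetoid ignores membership proofs, so `φ` and `ψ` may be total maps that are
-- mutually inverse only on `P` and `Q`. This allows a projection such as `proj₁` as an inverse,
-- although it loses information off the subset.
subsetoid-inverse :
  (S : Setoid a ℓ) (T : Setoid b ℓ′) {P : Pred (Setoid.Carrier S) p} {Q : Pred (Setoid.Carrier T) q}
  (let module S = Setoid S; module T = Setoid T)
  (φ : S.Carrier → T.Carrier) (ψ : T.Carrier → S.Carrier) →
  Congruent S._≈_ T._≈_ φ → Congruent T._≈_ S._≈_ ψ →
  (∀ {x} → x ∈ P → φ x ∈ Q) → (∀ {y} → y ∈ Q → ψ y ∈ P) →
  (∀ {y} → y ∈ Q → φ (ψ y) T.≈ y) → (∀ {x} → x ∈ P → ψ (φ x) S.≈ x) →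
  Inverse (subsetoid S P) (subsetoid T Q)
subsetoid-inverse S T φ ψ φ-cong ψ-cong PQ QP φψ ψφ = record
  { to        = λ (x , x∈P) → φ x , PQ x∈P
  ; from      = λ (y , y∈Q) → ψ y , QP y∈Q
  ; to-cong   = φ-cong
  ; from-cong = ψ-cong
  ; inverse   = (λ {(_ , y∈Q)} eq → T.trans (φ-cong eq) (φψ y∈Q))
              , (λ {(_ , x∈P)} eq → S.trans (ψ-cong eq) (ψφ x∈P))
  }
  where
  module S = Setoid S
  module T = Setoid T

-- The enumeration and the indicator sum arise from the same recursion, so they agree by
-- construction. If `zero` lies in `P`, it takes index 0 and the old indices move up; otherwise only
-- the elements are shifted.
countFin : ∀ n {P : Pred (Fin n) p} (P? : Decidable P) →
           Σ[ m ∈ ℕ ] HasCardinality (subsetoid (≡.setoid (Fin n)) P) m × sum (χ ∘ P?) ≡ + m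
countFin zero P? = 0 , record
  { to        = λ ()
  ; from      = λ ()
  ; to-cong   = λ {}
  ; from-cong = λ { {() , _} }
  ; inverse   = (λ { {() , _} }) , λ { {()} }
  } , refl
countFin (suc n) {P} P? with P? zero | countFin n (P? ∘ suc)
... | yes p₀ | m , F , eq = suc m , record
  { to        = λ { zero → zero , p₀ ; (suc i) → suc (proj₁ (F.to i)) , proj₂ (F.to i) }
  ; from      = λ { (zero , _) → zero ; (suc j , p) → suc (F.from (j , p)) }
  ; to-cong   = λ { refl → refl }
  ; from-cong = λ { {zero , _} {zero , _} refl → refl
                  ; {suc j , _} {suc .j , _} refl → cong suc (F.from-cong refl) }
  ; inverse   = (λ { {zero , _} refl → refl
                   ; {suc j , p} refl → cong suc (F.inverseˡ refl) })
              , λ { {zero} {zero , _} _ → refl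
                  ; {suc i} {suc j , p} eq → cong suc (F.inverseʳ (Fin.suc-injective eq)) }
  } , cong (λ k → 1ℤ +ᶻ k) eq
  where
  module F = Inverse F
... | no ¬p₀ | m , F , eq = m , record
  { to        = λ i → suc (proj₁ (F.to i)) , proj₂ (F.to i)
  ; from      = λ { (zero , p₀) → contradiction p₀ ¬p₀ ; (suc j , p) → F.from (j , p) }
  ; to-cong   = λ { refl → refl }
  ; from-cong = λ { {zero , p₀} _ → contradiction p₀ ¬p₀
                  ; {suc j , _} {suc .j , _} refl → F.from-cong refl }
  ; inverse   = (λ { {zero , p₀} _ → contradiction p₀ ¬p₀
                   ; {suc j , p} refl → cong suc (F.inverseˡ refl) })
              , λ { {_} {zero , p₀} _ → contradiction p₀ ¬p₀
                  ; {_} {suc j , p} eq → F.inverseʳ (Fin.suc-injective eq) }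
  } , trans (ℤ.+-identityˡ _) eq
  where
  module F = Inverse F

-- Sums over a finite setoid.

module Summation (S : Setoid a ℓ) {n : ℕ} (finite : HasCardinality S n) where

  private
    module S = Setoid S
    module e = Inverse finite
  open S using (Carrier; _≈_)

  ∑ : (Carrier → ℤ) → ℤ
  ∑ h = sum (h ∘ e.to)

  infix 4 _≟_

  -- The setoid comes without a decision procedure; the enumeration supplies one, by comparing
  -- indices.
  _≟_ : Decidable₂ _≈_
  x ≟ y = map′
    (λ eq → S.trans (S.sym (e.strictlyInverseˡ x)) (e.inverseˡ eq))
    e.from-cong
    (e.from x Fin.≟ e.from y)

  ∑-cong : ∀ {h h′} → (∀ x → h x ≡ h′ x) → ∑ h ≡ ∑ h′
  ∑-cong eq = sum-cong-≗ (eq ∘ e.to)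

  *-distribˡ-∑ : ∀ k h → k *ᶻ ∑ h ≡ ∑ (λ x → k *ᶻ h x)
  *-distribˡ-∑ k h = *-distribˡ-sum k (h ∘ e.to)

  ∑-+ : ∀ h h′ → ∑ (λ x → h x +ᶻ h′ x) ≡ ∑ h +ᶻ ∑ h′
  ∑-+ h h′ = ∑-distrib-+ (h ∘ e.to) (h′ ∘ e.to)

  -- Expanded squares and products of weights are all brought to this three-term shape, so that a
  -- single step of linearity splits each of them.
  ∑-linear : ∀ j k h₀ h₁ h₂ →
    ∑ (λ x → h₀ x +ᶻ (j *ᶻ h₁ x +ᶻ k *ᶻ h₂ x)) ≡ ∑ h₀ +ᶻ (j *ᶻ ∑ h₁ +ᶻ k *ᶻ ∑ h₂)
  ∑-linear j k h₀ h₁ h₂ =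
    trans (∑-+ h₀ (λ x → j *ᶻ h₁ x +ᶻ k *ᶻ h₂ x))
      (cong (∑ h₀ +ᶻ_)
        (trans (∑-+ (λ x → j *ᶻ h₁ x) (λ x → k *ᶻ h₂ x))
          (cong₂ _+ᶻ_ (sym (*-distribˡ-∑ j h₁)) (sym (*-distribˡ-∑ k h₂)))))

  ∑-*-∑ : ∀ h h′ → ∑ h *ᶻ ∑ h′ ≡ ∑ λ x → ∑ λ y → h x *ᶻ h′ y
  ∑-*-∑ h h′ =
    trans (*-distribʳ-sum (∑ h′) (h ∘ e.to)) (∑-cong λ x → *-distribˡ-∑ (h x) h′)

  ∑-swap : ∀ (h : Carrier → Carrier → ℤ) → (∑ λ x → ∑ λ y → h x y) ≡ ∑ λ y → ∑ λ x → h x y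
  ∑-swap h = ∑-comm λ i j → h (e.to i) (e.to j)

  -- Conjugating `σ` by the enumeration gives a permutation of `Fin n`. Congruence of `h` enters
  -- because `e.to` after `e.from` is the identity only up to `_≈_`.
  ∑-reindex : (σ : Inverse S S) {h : Carrier → ℤ} → Congruent _≈_ _≡_ h →
              ∑ (h ∘ Inverse.to σ) ≡ ∑ h
  ∑-reindex σ {h} h-cong = sym (trans
    (sum-permute (h ∘ e.to) (↔-trans (↔-trans finite σ) (↔-sym finite)))
    (sum-cong-≗ λ i → h-cong (e.strictlyInverseˡ (Inverse.to σ (e.to i)))))

  ∑-nonNeg≡0 : {h : Carrier → ℤ} → Congruent _≈_ _≡_ h → (∀ x → 0ℤ ℤ.≤ h x) →
               ∑ h ≡ 0ℤ → ∀ x → h x ≡ 0ℤ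
  ∑-nonNeg≡0 {h} h-cong 0≤h eq x = trans (h-cong (S.sym (e.strictlyInverseˡ x)))
    (nonNeg-sum≡0 (h ∘ e.to) (0≤h ∘ e.to) eq (e.from x))

  private
    count : {Q : Pred Carrier q} → Q Respects _≈_ → (Q? : Decidable Q) →
            Σ[ m ∈ ℕ ] HasCardinality (subsetoid S Q) m × ∑ (χ ∘ Q?) ≡ + m
    count {Q = Q} Q-resp Q? with countFin n (Q? ∘ e.to)
    ... | m , F , eq = m , ↔-trans F (subsetoid-inverse (≡.setoid _) S e.to e.from
      e.to-cong e.from-cong id (Q-resp (S.sym (e.strictlyInverseˡ _)))
      (λ _ → e.strictlyInverseˡ _) (λ _ → e.strictlyInverseʳ _)) , eq

  cardinality⇒∑χ : ∀ {m} {Q : Pred Carrier q} → Q Respects _≈_ → (Q? : Decidable Q) →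
                   HasCardinality (subsetoid S Q) m → ∑ (χ ∘ Q?) ≡ + m
  cardinality⇒∑χ {Q = Q} Q-resp Q? F with count Q-resp Q?
  ... | m , F′ , eq = trans eq (cong +_ (cardinality-unique {S = subsetoid S Q} F′ F))

  -- The bijection comes from `count`; the sum only identifies the number. The factor `k` avoids
  -- division, since weights give 2 times the indicator of a set, and 4 times that of an
  -- intersection.
  ∑χ⇒cardinality : ∀ k .{{_ : ℤ.NonZero k}} {m} {Q : Pred Carrier q} →
                   Q Respects _≈_ → (Q? : Decidable Q) →
                   ∑ (λ x → k *ᶻ χ (Q? x)) ≡ k *ᶻ + m → HasCardinality (subsetoid S Q) m
  ∑χ⇒cardinality k {Q = Q} Q-resp Q? eq with count Q-resp Q?
  ... | m , F , eq′ = subst (HasCardinality (subsetoid S Q))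
    (ℤ.+-injective (trans (sym eq′) (ℤ.*-cancelˡ-≡ k _ _ (trans (*-distribˡ-∑ k (χ ∘ Q?)) eq)))) F

  δ : Carrier → Carrier → ℤ
  δ x y = χ (x ≟ y)

  δ-cong : ∀ {x x′ y y′} → x ≈ x′ → y ≈ y′ → δ x y ≡ δ x′ y′
  δ-cong {x} {x′} {y} {y′} p q = χ-cong (x ≟ y) (x′ ≟ y′)
    (λ r → S.trans (S.sym p) (S.trans r q)) (λ r → S.trans p (S.trans r (S.sym q)))

  δ-sym : ∀ x y → δ x y ≡ δ y x
  δ-sym x y = χ-cong (x ≟ y) (y ≟ x) S.sym S.sym

  δ-diagonal : ∀ {x y} → x ≈ y → δ x y ≡ 1ℤ
  δ-diagonal {x} {y} = χ-yes (x ≟ y)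

  δ-offDiagonal : ∀ {x y} → ¬ x ≈ y → δ x y ≡ 0ℤ
  δ-offDiagonal {x} {y} = χ-no (x ≟ y)

  δ-replace : ∀ {h} → Congruent _≈_ _≡_ h → ∀ x y → δ x y *ᶻ h y ≡ h x *ᶻ δ x y
  δ-replace {h} h-cong x y with x ≟ y
  ... | yes x≈y = trans (ℤ.*-identityˡ _) (trans (h-cong (S.sym x≈y)) (sym (ℤ.*-identityʳ _)))
  ... | no  _   = sym (ℤ.*-zeroʳ (h x))

  -- The elements equal to `x` form a subsetoid of cardinality 1, so no index computation is
  -- involved.
  ∑δ≡1 : ∀ x → ∑ (δ x) ≡ 1ℤ
  ∑δ≡1 x = cardinality⇒∑χ {m = 1} (λ p q → S.trans q p) (x ≟_) record
    { to        = λ _ → x , S.refl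
    ; from      = λ _ → zero
    ; to-cong   = λ _ → S.refl
    ; from-cong = λ _ → refl
    ; inverse   = (λ { {_ , x≈y} _ → x≈y }) , λ { {zero} _ → refl }
    }

  ∑δ* : ∀ {h} → Congruent _≈_ _≡_ h → ∀ x → ∑ (λ y → δ x y *ᶻ h y) ≡ h x
  ∑δ* {h} h-cong x = begin
    ∑ (λ y → δ x y *ᶻ h y)  ≡⟨ ∑-cong (δ-replace h-cong x) ⟩
    ∑ (λ y → h x *ᶻ δ x y)  ≡⟨ *-distribˡ-∑ (h x) (δ x) ⟨
    h x *ᶻ ∑ (δ x)          ≡⟨ cong (h x *ᶻ_) (∑δ≡1 x) ⟩
    h x *ᶻ 1ℤ               ≡⟨ ℤ.*-identityʳ (h x) ⟩
    h x                     ∎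
    where open ≡-Reasoning

  ∑-const : ∀ k → ∑ (λ _ → k) ≡ + n *ᶻ k
  ∑-const k = sum-const n
    where
    sum-const : ∀ m → sum {m} (λ _ → k) ≡ + m *ᶻ k
    sum-const zero    = sym (ℤ.*-zeroˡ k)
    sum-const (suc m) = trans (cong (k +ᶻ_) (sum-const m)) (sym (ℤ.suc-* (+ m) k))

-- Products of finite setoids.

Fin-×-inverse : ∀ {m n} → HasCardinality (≡.setoid (Fin m) ×ₛ ≡.setoid (Fin n)) (m ℕ.* n)
Fin-×-inverse = ↔-trans Fin.*↔× (↔-sym Pointwise-≡↔≡)

module Square (S : Setoid a ℓ) {n : ℕ} (finite : HasCardinality S n) where

  finite² : HasCardinality (S ×ₛ S) (n ℕ.* n)
  finite² = ↔-trans Fin-×-inverse (finite ×-inverse finite)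

  open Summation S finite using (∑)
  private module Σ² = Summation (S ×ₛ S) finite²

  -- `finite²` lists the pairs lexicographically, so cutting its index set into blocks of length `n`
  -- yields the iterated sum.
  ∑² : ∀ h → Σ².∑ h ≡ ∑ λ x → ∑ λ y → h (x , y)
  ∑² h = trans (sum-combine n (h ∘ Inverse.to finite²))
    (sum-cong-≗ λ i → sum-cong-≗ λ j →
      cong (λ (i , j) → h (Inverse.to finite i , Inverse.to finite j)) (Fin.remQuot-combine {n} i j))

-- Finite groups: translations and autocorrelations.

module FiniteGroup (G : Group a ℓ) {n : ℕ} (finite : HasCardinality (Group.setoid G) n) where

  open Group G using (Carrier; _≈_; _∙_; ε; _⁻¹; setoid; ∙-congˡ; ∙-congʳ)
  private module G = Group G
  open import Algebra.Properties.Group G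
    using (\\-leftDividesˡ; \\-leftDividesʳ; //-rightDividesˡ; //-rightDividesʳ)
  open Summation setoid finite public
  open Square setoid finite public
  open ≡-Reasoning

  leftTranslation : Carrier → Inverse setoid setoid
  leftTranslation g = record
    { to        = g ∙_
    ; from      = g ⁻¹ ∙_
    ; to-cong   = ∙-congˡ
    ; from-cong = ∙-congˡ
    ; inverse   = (λ eq → G.trans (∙-congˡ eq) (\\-leftDividesˡ g _))
                , (λ eq → G.trans (∙-congˡ eq) (\\-leftDividesʳ g _))
    }

  rightTranslation : Carrier → Inverse setoid setoid
  rightTranslation g = record
    { to        = _∙ g
    ; from      = _∙ g ⁻¹
    ; to-cong   = ∙-congʳ
    ; from-cong = ∙-congʳ
    ; inverse   = (λ eq → G.trans (∙-congʳ eq) (//-rightDividesˡ g _))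
                , (λ eq → G.trans (∙-congʳ eq) (//-rightDividesʳ g _))
    }

  module Autocorrelation (f : Carrier → ℤ) (f-cong : Congruent _≈_ _≡_ f) where

    -- Without commutativity the two may differ. Differences x - x′ = g mean x = g + x′ and lead to
    -- the left one; differences -x + x′ = g mean x′ = x + g and lead to the right one.
    leftCorrelation rightCorrelation : Carrier → ℤ
    leftCorrelation  g = ∑ λ x → f (g ∙ x) *ᶻ f x
    rightCorrelation g = ∑ λ x → f (x ∙ g) *ᶻ f x

    leftCorrelation-cong : Congruent _≈_ _≡_ leftCorrelation
    leftCorrelation-cong g≈h = ∑-cong λ x → cong (_*ᶻ f x) (f-cong (∙-congʳ {x} g≈h))

    rightCorrelation-cong : Congruent _≈_ _≡_ rightCorrelation
    rightCorrelation-cong g≈h = ∑-cong λ x → cong (_*ᶻ f x) (f-cong (∙-congˡ {x} g≈h))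

    -- Both sides are the sum of f x f (x g) f (h x) f (h x g) over all g, h, x.
    ∑rightCorrelation² : ∑ (λ g → rightCorrelation g *ᶻ rightCorrelation g) ≡
                         ∑ (λ h → leftCorrelation h *ᶻ leftCorrelation h)
    ∑rightCorrelation² = begin
      ∑ (λ g → rightCorrelation g *ᶻ rightCorrelation g)
        ≡⟨ ∑-cong (λ g → ∑-*-∑ (R g) (R g)) ⟩
      (∑ λ g → ∑ λ x → ∑ λ y → R g x *ᶻ R g y)
        ≡⟨ ∑-cong (λ g → ∑-swap λ x y → R g x *ᶻ R g y) ⟩
      (∑ λ g → ∑ λ y → ∑ λ x → R g x *ᶻ R g y)
        -- The innermost variable is replaced by h x: for a fixed x, each group element has this
        -- form for exactly one h.
        ≡⟨ ∑-cong (λ g → ∑-cong λ x → ∑-reindex (rightTranslation x) λ y≈z →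
             cong (_*ᶻ R g x) (R-cong g y≈z)) ⟨
      (∑ λ g → ∑ λ x → ∑ λ h → R g (h ∙ x) *ᶻ R g x)
        ≡⟨ ∑-cong (λ g → ∑-cong λ x → ∑-cong λ h → rectangle g h x) ⟩
      (∑ λ g → ∑ λ x → ∑ λ h → L h (x ∙ g) *ᶻ L h x)
        ≡⟨ ∑-cong (λ g → ∑-swap λ x h → L h (x ∙ g) *ᶻ L h x) ⟩
      (∑ λ g → ∑ λ h → ∑ λ x → L h (x ∙ g) *ᶻ L h x)
        ≡⟨ ∑-swap (λ g h → ∑ λ x → L h (x ∙ g) *ᶻ L h x) ⟩
      (∑ λ h → ∑ λ g → ∑ λ x → L h (x ∙ g) *ᶻ L h x)
        ≡⟨ ∑-cong (λ h → ∑-swap λ g x → L h (x ∙ g) *ᶻ L h x) ⟩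
      (∑ λ h → ∑ λ x → ∑ λ g → L h (x ∙ g) *ᶻ L h x)
        ≡⟨ ∑-cong (λ h → ∑-cong λ x → ∑-reindex (leftTranslation x) λ y≈z →
             cong (_*ᶻ L h x) (L-cong h y≈z)) ⟩
      (∑ λ h → ∑ λ x → ∑ λ y → L h y *ᶻ L h x)
        ≡⟨ ∑-cong (λ h → ∑-swap λ x y → L h y *ᶻ L h x) ⟩
      (∑ λ h → ∑ λ y → ∑ λ x → L h y *ᶻ L h x)
        ≡⟨ ∑-cong (λ h → ∑-*-∑ (L h) (L h)) ⟨
      ∑ (λ h → leftCorrelation h *ᶻ leftCorrelation h) ∎
      where
      R L : Carrier → Carrier → ℤ
      R g x = f (x ∙ g) *ᶻ f x
      L h x = f (h ∙ x) *ᶻ f x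
      R-cong : ∀ g → Congruent _≈_ _≡_ (R g)
      R-cong g x≈y = cong₂ _*ᶻ_ (f-cong (∙-congʳ x≈y)) (f-cong x≈y)
      L-cong : ∀ h → Congruent _≈_ _≡_ (L h)
      L-cong h x≈y = cong₂ _*ᶻ_ (f-cong (∙-congˡ x≈y)) (f-cong x≈y)
      exchange : ∀ i j k l → (i *ᶻ j) *ᶻ (k *ᶻ l) ≡ (i *ᶻ k) *ᶻ (j *ᶻ l)
      exchange = solve-∀
      rectangle : ∀ g h x → R g (h ∙ x) *ᶻ R g x ≡ L h (x ∙ g) *ᶻ L h x
      rectangle g h x = trans
        (cong (λ k → (k *ᶻ f (h ∙ x)) *ᶻ (f (x ∙ g) *ᶻ f x)) (f-cong (G.assoc h x g)))
        (exchange (f (h ∙ (x ∙ g))) (f (h ∙ x)) (f (x ∙ g)) (f x))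

    module _ (f² : ∀ x → f x *ᶻ f x ≡ 1ℤ)
             (left≡0 : ∀ {g} → ¬ g ≈ ε → leftCorrelation g ≡ 0ℤ) where

      private
        N : ℤ
        N = + n

        deviation : Carrier → ℤ
        deviation g = rightCorrelation g +ᶻ - N *ᶻ δ ε g

        ∑1 : ∑ (λ _ → 1ℤ) ≡ N
        ∑1 = trans (∑-const 1ℤ) (ℤ.*-identityʳ N)

        left-ε : leftCorrelation ε ≡ N
        left-ε = trans (∑-cong λ x → trans (cong (_*ᶻ f x) (f-cong (G.identityˡ x))) (f² x)) ∑1

        right-ε : rightCorrelation ε ≡ N
        right-ε = trans (∑-cong λ x → trans (cong (_*ᶻ f x) (f-cong (G.identityʳ x))) (f² x)) ∑1

        -- Away from `ε` the correlation vanishes, so a factor `δ ε g` may be inserted; `∑δ*` then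
        -- reduces the sum to its term at `ε`.
        left² : ∀ g → leftCorrelation g *ᶻ leftCorrelation g ≡
                      δ ε g *ᶻ (leftCorrelation g *ᶻ leftCorrelation g)
        left² g with ε ≟ g
        ... | yes _  = sym (ℤ.*-identityˡ _)
        ... | no ε≉g = cong (λ k → k *ᶻ k) (left≡0 (ε≉g ∘ G.sym))

        ∑left² : ∑ (λ g → leftCorrelation g *ᶻ leftCorrelation g) ≡ N *ᶻ N
        ∑left² = begin
          ∑ (λ g → leftCorrelation g *ᶻ leftCorrelation g)
            ≡⟨ ∑-cong left² ⟩
          ∑ (λ g → δ ε g *ᶻ (leftCorrelation g *ᶻ leftCorrelation g))
            ≡⟨ ∑δ* (λ eq → cong (λ k → k *ᶻ k) (leftCorrelation-cong eq)) ε ⟩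
          leftCorrelation ε *ᶻ leftCorrelation ε
            ≡⟨ cong (λ k → k *ᶻ k) left-ε ⟩
          N *ᶻ N ∎

        expand : ∀ r k d → (r +ᶻ - k *ᶻ d) *ᶻ (r +ᶻ - k *ᶻ d) ≡
                           r *ᶻ r +ᶻ (- (+ 2 *ᶻ k) *ᶻ (d *ᶻ r) +ᶻ (k *ᶻ k) *ᶻ (d *ᶻ d))
        expand = solve-∀

        cancel : ∀ k → k *ᶻ k +ᶻ (- (+ 2 *ᶻ k) *ᶻ k +ᶻ (k *ᶻ k) *ᶻ 1ℤ) ≡ 0ℤ
        cancel = solve-∀

        -- The three terms of the expansion contribute N², -2 N² and N². The first is transferred
        -- from the left correlation; the other two are concentrated at `ε`.
        ∑deviation² : ∑ (λ g → deviation g *ᶻ deviation g) ≡ 0ℤ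
        ∑deviation² = begin
          ∑ (λ g → deviation g *ᶻ deviation g)
            ≡⟨ ∑-cong (λ g → expand (rightCorrelation g) N (δ ε g)) ⟩
          ∑ (λ g → rightCorrelation g *ᶻ rightCorrelation g +ᶻ
                   (- (+ 2 *ᶻ N) *ᶻ (δ ε g *ᶻ rightCorrelation g) +ᶻ (N *ᶻ N) *ᶻ (δ ε g *ᶻ δ ε g)))
            ≡⟨ ∑-linear (- (+ 2 *ᶻ N)) (N *ᶻ N) (λ g → rightCorrelation g *ᶻ rightCorrelation g)
                 (λ g → δ ε g *ᶻ rightCorrelation g) (λ g → δ ε g *ᶻ δ ε g) ⟩
          ∑ (λ g → rightCorrelation g *ᶻ rightCorrelation g) +ᶻ
          (- (+ 2 *ᶻ N) *ᶻ ∑ (λ g → δ ε g *ᶻ rightCorrelation g) +ᶻ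
           (N *ᶻ N) *ᶻ ∑ (λ g → δ ε g *ᶻ δ ε g))
            ≡⟨ cong₂ _+ᶻ_ (trans ∑rightCorrelation² ∑left²)
                 (cong₂ (λ i j → - (+ 2 *ᶻ N) *ᶻ i +ᶻ (N *ᶻ N) *ᶻ j)
                   (trans (∑δ* rightCorrelation-cong ε) right-ε)
                   (trans (∑δ* (δ-cong G.refl) ε) (δ-diagonal G.refl))) ⟩
          N *ᶻ N +ᶻ (- (+ 2 *ᶻ N) *ᶻ N +ᶻ (N *ᶻ N) *ᶻ 1ℤ)
            ≡⟨ cancel N ⟩
          0ℤ ∎

        deviation-cong : Congruent _≈_ _≡_ deviation
        deviation-cong eq =
          cong₂ (λ i j → i +ᶻ - N *ᶻ j) (rightCorrelation-cong eq) (δ-cong G.refl eq)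

        -- A vanishing sum of squares of integers has only zero terms.
        deviation≡0 : ∀ g → deviation g ≡ 0ℤ
        deviation≡0 g = i*i≡0⇒i≡0 (deviation g)
          (∑-nonNeg≡0 (λ eq → cong (λ k → k *ᶻ k) (deviation-cong eq))
            (λ x → 0≤i*i (deviation x)) ∑deviation² g)

      rightCorrelation≡0 : ∀ {g} → ¬ g ≈ ε → rightCorrelation g ≡ 0ℤ
      rightCorrelation≡0 {g} g≉ε = begin
        rightCorrelation g               ≡⟨ ℤ.+-identityʳ _ ⟨
        rightCorrelation g +ᶻ 0ℤ         ≡⟨ cong (rightCorrelation g +ᶻ_) (ℤ.*-zeroʳ (- N)) ⟨
        rightCorrelation g +ᶻ - N *ᶻ 0ℤ
          ≡⟨ cong (λ d → rightCorrelation g +ᶻ - N *ᶻ d) (δ-offDiagonal (g≉ε ∘ G.sym)) ⟨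
        deviation g                      ≡⟨ deviation≡0 g ⟩
        0ℤ                               ∎

-- Functions with values 1 and -1, and sums of the weights built from them.

module HadamardFunction
  (G : Group a ℓ) {n : ℕ} (finite : HasCardinality (Group.setoid G) n)
  (f : Group.Carrier G → ℤ) (f-cong : Congruent (Group._≈_ G) _≡_ f)
  (f² : ∀ x → f x *ᶻ f x ≡ 1ℤ)
  (left≡0 : ∀ {g} → ¬ Group._≈_ G g (Group.ε G) →
            FiniteGroup.Autocorrelation.leftCorrelation G finite f f-cong g ≡ 0ℤ)
  (∑f-squared : FiniteGroup.∑ G finite f *ᶻ FiniteGroup.∑ G finite f ≡ + n)
  where

  open Group G using (Carrier; _≈_; _∙_; ε; _⁻¹; setoid; ∙-congˡ; ∙-congʳ)
  open FiniteGroup G finite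
  open Autocorrelation f f-cong
  private module G = Group G
  open import Algebra.Properties.Group G
    using (\\-leftDividesˡ; \\-leftDividesʳ; //-rightDividesˡ; //-rightDividesʳ;
           ∙-cancelʳ; identityˡ-unique)
  open ≡-Reasoning

  private
    N S : ℤ
    N = + n
    S = ∑ f

    ∑1 : ∑ (λ _ → 1ℤ) ≡ N
    ∑1 = trans (∑-const 1ℤ) (ℤ.*-identityʳ N)

    right≡0 : ∀ {g} → ¬ g ≈ ε → rightCorrelation g ≡ 0ℤ
    right≡0 = rightCorrelation≡0 f² left≡0

    δ-translate : ∀ g x y → δ (x ∙ g) (y ∙ g) ≡ δ x y
    δ-translate g x y = χ-cong (x ∙ g ≟ y ∙ g) (x ≟ y) (∙-cancelʳ g x y) ∙-congʳ

  module Weight (s c : ℤ) (relation : c *ᶻ c ≡ - (+ 2 *ᶻ (c *ᶻ s))) where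

    weight : Carrier → Carrier → ℤ
    weight x y = 1ℤ +ᶻ (s *ᶻ (f x *ᶻ f y) +ᶻ c *ᶻ δ x y)

    weight-cong : ∀ {x x′ y y′} → x ≈ x′ → y ≈ y′ → weight x y ≡ weight x′ y′
    weight-cong p q = cong₂ (λ i j → 1ℤ +ᶻ (s *ᶻ i +ᶻ c *ᶻ j))
      (cong₂ _*ᶻ_ (f-cong p) (f-cong q)) (δ-cong p q)

    weight-sym : ∀ x y → weight x y ≡ weight y x
    weight-sym x y = cong₂ (λ i j → 1ℤ +ᶻ (s *ᶻ i +ᶻ c *ᶻ j)) (ℤ.*-comm (f x) (f y)) (δ-sym x y)

    -- As a matrix, `weight` is J + s f fᵀ + c I, with J the all-ones matrix; this is its action on
    -- a vector `h`. The inner sums below take `h` to be 1, `f`, or a row of the matrix, possibly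
    -- translated.
    ∑weight* : ∀ {h} → Congruent _≈_ _≡_ h → ∀ x →
      ∑ (λ y → weight x y *ᶻ h y) ≡
      ∑ h +ᶻ ((s *ᶻ f x) *ᶻ ∑ (λ y → f y *ᶻ h y) +ᶻ c *ᶻ h x)
    ∑weight* {h} h-cong x = begin
      ∑ (λ y → weight x y *ᶻ h y)
        ≡⟨ ∑-cong (λ y → expand (f x) (f y) (δ x y) (h y) s c) ⟩
      ∑ (λ y → h y +ᶻ ((s *ᶻ f x) *ᶻ (f y *ᶻ h y) +ᶻ c *ᶻ (δ x y *ᶻ h y)))
        ≡⟨ ∑-linear (s *ᶻ f x) c h (λ y → f y *ᶻ h y) (λ y → δ x y *ᶻ h y) ⟩
      ∑ h +ᶻ ((s *ᶻ f x) *ᶻ ∑ (λ y → f y *ᶻ h y) +ᶻ c *ᶻ ∑ (λ y → δ x y *ᶻ h y))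
        ≡⟨ cong (λ k → ∑ h +ᶻ ((s *ᶻ f x) *ᶻ ∑ (λ y → f y *ᶻ h y) +ᶻ c *ᶻ k)) (∑δ* h-cong x) ⟩
      ∑ h +ᶻ ((s *ᶻ f x) *ᶻ ∑ (λ y → f y *ᶻ h y) +ᶻ c *ᶻ h x) ∎
      where
      expand : ∀ u v d k s c → (1ℤ +ᶻ (s *ᶻ (u *ᶻ v) +ᶻ c *ᶻ d)) *ᶻ k ≡
                               k +ᶻ ((s *ᶻ u) *ᶻ (v *ᶻ k) +ᶻ c *ᶻ (d *ᶻ k))
      expand = solve-∀

    ∑weight : ∀ x → ∑ (weight x) ≡ N +ᶻ ((s *ᶻ f x) *ᶻ S +ᶻ c)
    ∑weight x = begin
      ∑ (weight x)                     ≡⟨ ∑-cong (λ y → ℤ.*-identityʳ (weight x y)) ⟨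
      ∑ (λ y → weight x y *ᶻ 1ℤ)       ≡⟨ ∑weight* (λ _ → refl) x ⟩
      ∑ (λ _ → 1ℤ) +ᶻ ((s *ᶻ f x) *ᶻ ∑ (λ y → f y *ᶻ 1ℤ) +ᶻ c *ᶻ 1ℤ)
        ≡⟨ cong₂ _+ᶻ_ ∑1 (cong₂ (λ i j → (s *ᶻ f x) *ᶻ i +ᶻ j)
             (∑-cong λ y → ℤ.*-identityʳ (f y)) (ℤ.*-identityʳ c)) ⟩
      N +ᶻ ((s *ᶻ f x) *ᶻ S +ᶻ c) ∎

    ∑f*weight : ∀ x → ∑ (λ y → f y *ᶻ weight x y) ≡ S +ᶻ ((s *ᶻ f x) *ᶻ N +ᶻ c *ᶻ f x)
    ∑f*weight x = begin
      ∑ (λ y → f y *ᶻ weight x y)      ≡⟨ ∑-cong (λ y → ℤ.*-comm (f y) (weight x y)) ⟩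
      ∑ (λ y → weight x y *ᶻ f y)      ≡⟨ ∑weight* f-cong x ⟩
      S +ᶻ ((s *ᶻ f x) *ᶻ ∑ (λ y → f y *ᶻ f y) +ᶻ c *ᶻ f x)
        ≡⟨ cong (λ k → S +ᶻ ((s *ᶻ f x) *ᶻ k +ᶻ c *ᶻ f x)) (trans (∑-cong f²) ∑1) ⟩
      S +ᶻ ((s *ᶻ f x) *ᶻ N +ᶻ c *ᶻ f x) ∎

    -- The product term sums to s S², and S² = N.
    ∑∑weight : (∑ λ x → ∑ λ y → weight x y) ≡ N *ᶻ N +ᶻ (s *ᶻ N +ᶻ c *ᶻ N)
    ∑∑weight = begin
      (∑ λ x → ∑ λ y → weight x y)
        ≡⟨ ∑-cong (λ x → trans (∑weight x) (rearrange N s (f x) S c)) ⟩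
      ∑ (λ x → N +ᶻ ((s *ᶻ S) *ᶻ f x +ᶻ c *ᶻ 1ℤ))
        ≡⟨ ∑-linear (s *ᶻ S) c (λ _ → N) f (λ _ → 1ℤ) ⟩
      ∑ (λ _ → N) +ᶻ ((s *ᶻ S) *ᶻ S +ᶻ c *ᶻ ∑ (λ _ → 1ℤ))
        ≡⟨ cong₂ _+ᶻ_ (∑-const N) (cong₂ _+ᶻ_
             (trans (ℤ.*-assoc s S S) (cong (s *ᶻ_) ∑f-squared)) (cong (c *ᶻ_) ∑1)) ⟩
      N *ᶻ N +ᶻ (s *ᶻ N +ᶻ c *ᶻ N) ∎
      where
      rearrange : ∀ N s u S c → N +ᶻ ((s *ᶻ u) *ᶻ S +ᶻ c) ≡ N +ᶻ ((s *ᶻ S) *ᶻ u +ᶻ c *ᶻ 1ℤ)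
      rearrange = solve-∀

    private
      value : ℤ
      value = N *ᶻ N +ᶻ + 2 *ᶻ (s *ᶻ N +ᶻ c *ᶻ N)

      -- The common end of the three double sums, once the sum over y is done. A translation `σ`
      -- preserves the sum of `f`, so the middle term gives s S (S + S) = 2 s N, while `h` collects
      -- what cancels.
      sum-up : ∀ (σ : Inverse setoid setoid) k h → ∑ h ≡ 0ℤ →
        ∑ (λ x → (N +ᶻ + 2 *ᶻ c) +ᶻ ((s *ᶻ S) *ᶻ (f x +ᶻ f (Inverse.to σ x)) +ᶻ k *ᶻ h x)) ≡ value
      sum-up σ k h ∑h≡0 = begin
        ∑ (λ x → (N +ᶻ + 2 *ᶻ c) +ᶻ ((s *ᶻ S) *ᶻ (f x +ᶻ f (Inverse.to σ x)) +ᶻ k *ᶻ h x))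
          ≡⟨ ∑-linear (s *ᶻ S) k (λ _ → N +ᶻ + 2 *ᶻ c) (λ x → f x +ᶻ f (Inverse.to σ x)) h ⟩
        ∑ (λ _ → N +ᶻ + 2 *ᶻ c) +ᶻ ((s *ᶻ S) *ᶻ ∑ (λ x → f x +ᶻ f (Inverse.to σ x)) +ᶻ k *ᶻ ∑ h)
          ≡⟨ cong₂ _+ᶻ_ (∑-const _) (cong₂ (λ i j → (s *ᶻ S) *ᶻ i +ᶻ k *ᶻ j)
               (trans (∑-+ f (f ∘ Inverse.to σ)) (cong (S +ᶻ_) (∑-reindex σ f-cong))) ∑h≡0) ⟩
        N *ᶻ (N +ᶻ + 2 *ᶻ c) +ᶻ ((s *ᶻ S) *ᶻ (S +ᶻ S) +ᶻ k *ᶻ 0ℤ)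
          ≡⟨ rearrange N c s S k ⟩
        N *ᶻ N +ᶻ + 2 *ᶻ (s *ᶻ (S *ᶻ S) +ᶻ c *ᶻ N)
          ≡⟨ cong (λ i → N *ᶻ N +ᶻ + 2 *ᶻ (s *ᶻ i +ᶻ c *ᶻ N)) ∑f-squared ⟩
        value ∎
        where
        rearrange : ∀ N c s S k → N *ᶻ (N +ᶻ + 2 *ᶻ c) +ᶻ ((s *ᶻ S) *ᶻ (S +ᶻ S) +ᶻ k *ᶻ 0ℤ) ≡
                                  N *ᶻ N +ᶻ + 2 *ᶻ (s *ᶻ (S *ᶻ S) +ᶻ c *ᶻ N)
        rearrange = solve-∀

    ∑∑weight₂ : ∀ {g} → ¬ g ≈ ε → (∑ λ x → ∑ λ y → weight (g ∙ x) y *ᶻ weight x y) ≡ value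
    ∑∑weight₂ {g} g≉ε = trans (∑-cong inner)
      -- The coefficient of f(g x) f(x) is s² N from the two product terms, plus c s for each
      -- pairing of a product term with a diagonal term. The two diagonal terms never meet, as g x ≠
      -- x.
      (sum-up (leftTranslation g) (s *ᶻ (s *ᶻ N +ᶻ + 2 *ᶻ c)) (λ x → f (g ∙ x) *ᶻ f x) (left≡0 g≉ε))
      where
      rearrange : ∀ N s c S u v →
        (N +ᶻ ((s *ᶻ u) *ᶻ S +ᶻ c)) +ᶻ
        ((s *ᶻ v) *ᶻ (S +ᶻ ((s *ᶻ u) *ᶻ N +ᶻ c *ᶻ u)) +ᶻ
         c *ᶻ (1ℤ +ᶻ (s *ᶻ (u *ᶻ v) +ᶻ c *ᶻ 0ℤ))) ≡
        (N +ᶻ + 2 *ᶻ c) +ᶻ ((s *ᶻ S) *ᶻ (u +ᶻ v) +ᶻ (s *ᶻ (s *ᶻ N +ᶻ + 2 *ᶻ c)) *ᶻ (v *ᶻ u))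
      rearrange = solve-∀
      inner : ∀ x → ∑ (λ y → weight (g ∙ x) y *ᶻ weight x y) ≡
        (N +ᶻ + 2 *ᶻ c) +ᶻ ((s *ᶻ S) *ᶻ (f x +ᶻ f (g ∙ x)) +ᶻ
          (s *ᶻ (s *ᶻ N +ᶻ + 2 *ᶻ c)) *ᶻ (f (g ∙ x) *ᶻ f x))
      inner x = begin
        ∑ (λ y → weight (g ∙ x) y *ᶻ weight x y)
          ≡⟨ ∑weight* (weight-cong G.refl) (g ∙ x) ⟩
        ∑ (weight x) +ᶻ ((s *ᶻ f (g ∙ x)) *ᶻ ∑ (λ y → f y *ᶻ weight x y) +ᶻ c *ᶻ weight x (g ∙ x))
          ≡⟨ cong₂ _+ᶻ_ (∑weight x) (cong₂ (λ i j → (s *ᶻ f (g ∙ x)) *ᶻ i +ᶻ c *ᶻ j) (∑f*weight x)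
               (cong (λ d → 1ℤ +ᶻ (s *ᶻ (f x *ᶻ f (g ∙ x)) +ᶻ c *ᶻ d)) (δ-offDiagonal x≉gx))) ⟩
        _ ≡⟨ rearrange N s c S (f x) (f (g ∙ x)) ⟩
        _ ∎
        where
        x≉gx : ¬ x ≈ g ∙ x
        x≉gx eq = g≉ε (identityˡ-unique g x (G.sym eq))

    -- Symmetry of the weight exchanges the coordinates and reduces this to `∑∑weight₂`.
    ∑∑weight₃ : ∀ {g} → ¬ g ≈ ε → (∑ λ x → ∑ λ y → weight x (g ∙ y) *ᶻ weight x y) ≡ value
    ∑∑weight₃ {g} g≉ε = begin
      (∑ λ x → ∑ λ y → weight x (g ∙ y) *ᶻ weight x y)
        ≡⟨ ∑-swap (λ x y → weight x (g ∙ y) *ᶻ weight x y) ⟩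
      (∑ λ y → ∑ λ x → weight x (g ∙ y) *ᶻ weight x y)
        ≡⟨ ∑-cong (λ y → ∑-cong λ x → cong₂ _*ᶻ_ (weight-sym x (g ∙ y)) (weight-sym x y)) ⟩
      (∑ λ y → ∑ λ x → weight (g ∙ y) x *ᶻ weight y x)
        ≡⟨ ∑∑weight₂ g≉ε ⟩
      value ∎

    -- The product terms now cancel within the sum over y, through the right correlation. Both
    -- coordinates move together, so the diagonal terms coincide and leave a remainder that
    -- `relation` removes.
    ∑∑weight₁ : ∀ {g} → ¬ g ≈ ε → (∑ λ x → ∑ λ y → weight x y *ᶻ weight (x ∙ g) (y ∙ g)) ≡ value
    ∑∑weight₁ {g} g≉ε = trans (∑-cong inner)
      (sum-up (rightTranslation g) 0ℤ (λ _ → 0ℤ) (trans (∑-const 0ℤ) (ℤ.*-zeroʳ N)))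
      where
      twisted : ∀ x → ∑ (λ y → f y *ᶻ weight (x ∙ g) (y ∙ g)) ≡ S +ᶻ c *ᶻ f x
      twisted x = begin
        ∑ (λ y → f y *ᶻ weight (x ∙ g) (y ∙ g))
          ≡⟨ ∑-cong (λ y → trans
               (cong (λ d → f y *ᶻ (1ℤ +ᶻ (s *ᶻ (f (x ∙ g) *ᶻ f (y ∙ g)) +ᶻ c *ᶻ d)))
                 (δ-translate g x y))
               (expand (f y) s (f (x ∙ g)) (f (y ∙ g)) c (δ x y))) ⟩
        ∑ (λ y → f y +ᶻ ((s *ᶻ f (x ∙ g)) *ᶻ (f (y ∙ g) *ᶻ f y) +ᶻ c *ᶻ (δ x y *ᶻ f y)))
          ≡⟨ ∑-linear (s *ᶻ f (x ∙ g)) c f (λ y → f (y ∙ g) *ᶻ f y) (λ y → δ x y *ᶻ f y) ⟩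
        S +ᶻ ((s *ᶻ f (x ∙ g)) *ᶻ rightCorrelation g +ᶻ c *ᶻ ∑ (λ y → δ x y *ᶻ f y))
          ≡⟨ cong (S +ᶻ_) (cong₂ _+ᶻ_
               (trans (cong ((s *ᶻ f (x ∙ g)) *ᶻ_) (right≡0 g≉ε)) (ℤ.*-zeroʳ (s *ᶻ f (x ∙ g))))
               (cong (c *ᶻ_) (∑δ* f-cong x))) ⟩
        S +ᶻ (0ℤ +ᶻ c *ᶻ f x)
          ≡⟨ cong (S +ᶻ_) (ℤ.+-identityˡ _) ⟩
        S +ᶻ c *ᶻ f x ∎
        where
        expand : ∀ v s u w c d → v *ᶻ (1ℤ +ᶻ (s *ᶻ (u *ᶻ w) +ᶻ c *ᶻ d)) ≡
                                 v +ᶻ ((s *ᶻ u) *ᶻ (w *ᶻ v) +ᶻ c *ᶻ (d *ᶻ v))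
        expand = solve-∀
      collect : ∀ N s c S u v →
        (N +ᶻ ((s *ᶻ v) *ᶻ S +ᶻ c)) +ᶻ
        ((s *ᶻ u) *ᶻ (S +ᶻ c *ᶻ u) +ᶻ c *ᶻ (1ℤ +ᶻ (s *ᶻ (v *ᶻ v) +ᶻ c *ᶻ 1ℤ))) ≡
        (N +ᶻ + 2 *ᶻ c) +ᶻ ((s *ᶻ S) *ᶻ (u +ᶻ v) +ᶻ (c *ᶻ c +ᶻ (c *ᶻ s) *ᶻ (u *ᶻ u +ᶻ v *ᶻ v)))
      collect = solve-∀
      inner : ∀ x → ∑ (λ y → weight x y *ᶻ weight (x ∙ g) (y ∙ g)) ≡
        (N +ᶻ + 2 *ᶻ c) +ᶻ ((s *ᶻ S) *ᶻ (f x +ᶻ f (x ∙ g)) +ᶻ 0ℤ *ᶻ 0ℤ)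
      inner x = begin
        ∑ (λ y → weight x y *ᶻ weight (x ∙ g) (y ∙ g))
          ≡⟨ ∑weight* (λ eq → weight-cong G.refl (∙-congʳ eq)) x ⟩
        ∑ (λ y → weight (x ∙ g) (y ∙ g)) +ᶻ
        ((s *ᶻ f x) *ᶻ ∑ (λ y → f y *ᶻ weight (x ∙ g) (y ∙ g)) +ᶻ c *ᶻ weight (x ∙ g) (x ∙ g))
          ≡⟨ cong₂ _+ᶻ_
               (trans (∑-reindex (rightTranslation g) (weight-cong G.refl)) (∑weight (x ∙ g)))
               (cong₂ (λ i j → (s *ᶻ f x) *ᶻ i +ᶻ c *ᶻ j) (twisted x)
                 (cong (λ d → 1ℤ +ᶻ (s *ᶻ (f (x ∙ g) *ᶻ f (x ∙ g)) +ᶻ c *ᶻ d)) (δ-diagonal G.refl))) ⟩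
        _ ≡⟨ collect N s c S (f x) (f (x ∙ g)) ⟩
        (N +ᶻ + 2 *ᶻ c) +ᶻ ((s *ᶻ S) *ᶻ (f x +ᶻ f (x ∙ g)) +ᶻ
          (c *ᶻ c +ᶻ (c *ᶻ s) *ᶻ (f x *ᶻ f x +ᶻ f (x ∙ g) *ᶻ f (x ∙ g))))
          ≡⟨ cong (λ k → (N +ᶻ + 2 *ᶻ c) +ᶻ ((s *ᶻ S) *ᶻ (f x +ᶻ f (x ∙ g)) +ᶻ k)) vanish ⟩
        _ ∎
        where
        -- Both squares are 1, which leaves c² + 2 c s.
        vanish : c *ᶻ c +ᶻ (c *ᶻ s) *ᶻ (f x *ᶻ f x +ᶻ f (x ∙ g) *ᶻ f (x ∙ g)) ≡ 0ℤ
        vanish = trans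
          (cong₂ _+ᶻ_ relation (trans
            (cong ((c *ᶻ s) *ᶻ_) (cong₂ _+ᶻ_ (f² x) (f² (x ∙ g))))
            (ℤ.*-comm (c *ᶻ s) (+ 2))))
          (ℤ.+-inverseˡ (+ 2 *ᶻ (c *ᶻ s)))

    -- In each condition one of the two points of `P` determines the other by a translation by g.
    -- The solutions thus correspond to single points of G² whose two images lie in `P`, and a sum
    -- of products of weights counts these.
    propriety3 : ∀ {p K Λ} {P : Pred (Carrier × Carrier) p} →
      P Respects (Setoid._≈_ (setoid ×ₛ setoid)) → (P? : Decidable P) →
      (∀ x y → + 2 *ᶻ χ (P? (x , y)) ≡ weight x y) →
      + 2 *ᶻ + K ≡ N *ᶻ N +ᶻ (s *ᶻ N +ᶻ c *ᶻ N) →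
      + 4 *ᶻ + Λ ≡ N *ᶻ N +ᶻ + 2 *ᶻ (s *ᶻ N +ᶻ c *ᶻ N) →
      IsDifferenceSetOfPropriety3 G n K Λ P
    propriety3 {K = K} {Λ} {P} P-resp P? χP K-eq Λ-eq = record
      { order        = finite
      ; respects     = P-resp
      ; size         = Σ².∑χ⇒cardinality (+ 2) P-resp P?
          (trans (∑² (λ z → + 2 *ᶻ χ (P? z)))
            (trans (∑-cong λ x → ∑-cong λ y → χP x y) (trans ∑∑weight (sym K-eq))))
      ; differences₁ = λ g g≉ε → ↔-trans
          (cardinality-of-pair id (λ (x , y) → x ∙ g , y ∙ g) id
            (λ (p , q) → ∙-congʳ p , ∙-congʳ q) (∑∑weight₁ g≉ε))
          -- The first point is kept: the equations make the second its right translate by g in both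
          -- coordinates.
          (subsetoid-inverse G² (G² ×ₛ G²) (λ (x , y) → (x , y) , (x ∙ g , y ∙ g)) proj₁
            (λ (p , q) → (p , q) , (∙-congʳ p , ∙-congʳ q)) proj₁
            (λ {(x , y)} (Pxy , Pxgyg) → Pxy , Pxgyg ,
              G.trans (\\-leftDividesʳ x g) (G.sym (\\-leftDividesʳ y g)) , \\-leftDividesʳ y g)
            (λ {((x , y) , (x′ , y′))} (Pxy , Px′y′ , eq , eq′) → Pxy ,
              P-resp (shift₁ (G.trans eq eq′) , shift₁ eq′) Px′y′)
            (λ (_ , _ , eq , eq′) → (G.refl , G.refl) ,
              (G.sym (shift₁ (G.trans eq eq′)) , G.sym (shift₁ eq′)))
            (λ _ → G.refl , G.refl))
      ; differences₂ = λ g g≉ε → ↔-trans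
          (cardinality-of-pair (λ (x , y) → g ∙ x , y) id
            (λ (p , q) → ∙-congˡ p , q) id (∑∑weight₂ g≉ε))
          -- The second point is kept here, since x - x′ = g expresses x as g + x′.
          (subsetoid-inverse G² (G² ×ₛ G²) (λ (x , y) → (g ∙ x , y) , (x , y)) proj₂
            (λ (p , q) → (∙-congˡ p , q) , (p , q)) proj₂
            (λ {(x , y)} (Pgxy , Pxy) → Pgxy , Pxy , //-rightDividesʳ x g , G.refl)
            (λ (Pxy , Px′y′ , eq , y≈y′) → P-resp (shift₂ eq , y≈y′) Pxy , Px′y′)
            (λ (_ , _ , eq , y≈y′) → (G.sym (shift₂ eq) , G.sym y≈y′) , (G.refl , G.refl))
            (λ _ → G.refl , G.refl))
      ; differences₃ = λ g g≉ε → ↔-trans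
          (cardinality-of-pair (λ (x , y) → x , g ∙ y) id
            (λ (p , q) → p , ∙-congˡ q) id (∑∑weight₃ g≉ε))
          (subsetoid-inverse G² (G² ×ₛ G²) (λ (x , y) → (x , g ∙ y) , (x , y)) proj₂
            (λ (p , q) → (p , ∙-congˡ q) , (p , q)) proj₂
            (λ {(x , y)} (Pxgy , Pxy) → Pxgy , Pxy , G.refl , //-rightDividesʳ y g)
            (λ (Pxy , Px′y′ , x≈x′ , eq) → P-resp (x≈x′ , shift₂ eq) Pxy , Px′y′)
            (λ (_ , _ , x≈x′ , eq) → (G.sym x≈x′ , G.sym (shift₂ eq)) , (G.refl , G.refl))
            (λ _ → G.refl , G.refl))
      }
      where
      G² : Setoid _ _
      G² = setoid ×ₛ setoid
      module G² = Setoid G²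
      module Σ² = Summation G² finite²

      shift₁ : ∀ {g x x′} → x ⁻¹ ∙ x′ ≈ g → x′ ≈ x ∙ g
      shift₁ {x = x} {x′} eq = G.trans (G.sym (\\-leftDividesˡ x x′)) (∙-congˡ eq)

      shift₂ : ∀ {g x x′} → x ∙ x′ ⁻¹ ≈ g → x ≈ g ∙ x′
      shift₂ {x = x} {x′} eq = G.trans (G.sym (//-rightDividesˡ x′ x)) (∙-congʳ eq)

      -- The indicator of the intersection is a product of two indicators, and 4 = 2 · 2 turns each
      -- into a weight.
      cardinality-of-pair : (α β : Carrier × Carrier → Carrier × Carrier) →
        Congruent G²._≈_ G²._≈_ α → Congruent G²._≈_ G²._≈_ β →
        (∑ λ x → ∑ λ y → weight (proj₁ (α (x , y))) (proj₂ (α (x , y))) *ᶻ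
                         weight (proj₁ (β (x , y))) (proj₂ (β (x , y)))) ≡ value →
        HasCardinality (subsetoid G² (λ z → α z ∈ P × β z ∈ P)) Λ
      cardinality-of-pair α β α-cong β-cong eq = Σ².∑χ⇒cardinality (+ 4)
        (λ z≈z′ (Pα , Pβ) → P-resp (α-cong z≈z′) Pα , P-resp (β-cong z≈z′) Pβ)
        (λ z → P? (α z) ×-dec P? (β z))
        (trans (∑² (λ z → + 4 *ᶻ χ (P? (α z) ×-dec P? (β z))))
          (trans (∑-cong λ x → ∑-cong λ y → factor (α (x , y)) (β (x , y))) (trans eq (sym Λ-eq))))
        where
        split : ∀ i j → + 4 *ᶻ (i *ᶻ j) ≡ (+ 2 *ᶻ i) *ᶻ (+ 2 *ᶻ j)
        split = solve-∀
        factor : ∀ z w → + 4 *ᶻ χ (P? z ×-dec P? w) ≡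
                         weight (proj₁ z) (proj₂ z) *ᶻ weight (proj₁ w) (proj₂ w)
        factor z w = trans (cong (+ 4 *ᶻ_) (χ-× (P? z) (P? w)))
          (trans (split (χ (P? z)) (χ (P? w))) (cong₂ _*ᶻ_ (χP _ _) (χP _ _)))

-- The sign function of a difference set.

module DifferenceSet
  (G : Group a ℓ) {v : ℕ} (finite : HasCardinality (Group.setoid G) v)
  {k λ′ : ℕ} (D : Pred (Group.Carrier G) p) (isDifferenceSet : IsDifferenceSet G v k λ′ D)
  where

  open Group G using (Carrier; _≈_; _∙_; ε; _⁻¹; setoid; ∙-congˡ; ∙-congʳ)
  private module G = Group G
  open import Algebra.Properties.Group G using (//-rightDividesˡ; //-rightDividesʳ)
  open FiniteGroup G finite
  open IsDifferenceSet isDifferenceSet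
  open ≡-Reasoning

  -- Membership is not assumed decidable. The enumeration in `size` decides it by a search for an
  -- equal element among the `k` listed ones.
  D? : Decidable D
  D? x = map′ (λ (i , eq) → respects eq (proj₂ (Inverse.to size i)))
    (λ x∈D → Inverse.from size (x , x∈D) , Inverse.strictlyInverseˡ size (x , x∈D))
    (Fin.any? λ i → proj₁ (Inverse.to size i) ≟ x)

  ∁D-respects : ∁ D Respects _≈_
  ∁D-respects x≈y x∉D y∈D = x∉D (respects (G.sym x≈y) y∈D)

  sign : Carrier → ℤ
  sign x = -[1+ 0 ] +ᶻ + 2 *ᶻ χ (D? x)

  sign-cong : Congruent _≈_ _≡_ sign
  sign-cong {x} {y} x≈y = cong (λ i → -[1+ 0 ] +ᶻ + 2 *ᶻ i)
    (χ-cong (D? x) (D? y) (respects x≈y) (respects (G.sym x≈y)))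

  sign² : ∀ x → sign x *ᶻ sign x ≡ 1ℤ
  sign² x with D? x
  ... | yes _ = refl
  ... | no  _ = refl

  open Autocorrelation sign sign-cong

  ∑sign : ∑ sign ≡ - (+ v) +ᶻ + 2 *ᶻ + k
  ∑sign = begin
    ∑ sign
      ≡⟨ ∑-+ (λ _ → -[1+ 0 ]) (λ x → + 2 *ᶻ χ (D? x)) ⟩
    ∑ (λ _ → -[1+ 0 ]) +ᶻ ∑ (λ x → + 2 *ᶻ χ (D? x))
      ≡⟨ cong₂ _+ᶻ_ (trans (∑-const -[1+ 0 ]) (trans (ℤ.*-comm (+ v) -[1+ 0 ]) (ℤ.-1*i≡-i (+ v))))
           (sym (*-distribˡ-∑ (+ 2) (χ ∘ D?))) ⟩
    - (+ v) +ᶻ + 2 *ᶻ ∑ (χ ∘ D?)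
      ≡⟨ cong (λ i → - (+ v) +ᶻ + 2 *ᶻ i) (cardinality⇒∑χ respects D? size) ⟩
    - (+ v) +ᶻ + 2 *ᶻ + k ∎

  -- A pair counted by `differences` is determined by its second entry x′, the first being g + x′.
  ∑χχ : ∀ {g} → ¬ g ≈ ε → ∑ (λ x → χ (D? (g ∙ x)) *ᶻ χ (D? x)) ≡ + λ′
  ∑χχ {g} g≉ε = trans (∑-cong λ x → sym (χ-× (D? (g ∙ x)) (D? x)))
    (cardinality⇒∑χ (λ x≈y (p , q) → respects (∙-congˡ x≈y) p , respects x≈y q)
      (λ x → D? (g ∙ x) ×-dec D? x)
      (↔-trans (differences g g≉ε)
        (subsetoid-inverse (setoid ×ₛ setoid) setoid proj₂ (λ x → g ∙ x , x)
          proj₂ (λ eq → ∙-congˡ eq , eq)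
          (λ (x∈D , x′∈D , eq) → respects (shift eq) x∈D , x′∈D)
          (λ {x} (gx∈D , x∈D) → gx∈D , x∈D , //-rightDividesʳ x g)
          (λ _ → G.refl)
          (λ (_ , _ , eq) → G.sym (shift eq) , G.refl))))
    where
    shift : ∀ {x x′} → x ∙ x′ ⁻¹ ≈ g → x ≈ g ∙ x′
    shift {x} {x′} eq = G.trans (G.sym (//-rightDividesˡ x′ x)) (∙-congʳ eq)

  -- Expanding (2 χ - 1)(2 χ - 1) leaves two single indicators, each of sum `k` by translation
  -- invariance, and the product counted by `∑χχ`.
  leftCorrelation-sign : ∀ {g} → ¬ g ≈ ε →
    leftCorrelation g ≡ + v +ᶻ (- (+ 4) *ᶻ + k +ᶻ + 4 *ᶻ + λ′)
  leftCorrelation-sign {g} g≉ε = begin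
    leftCorrelation g
      ≡⟨ ∑-cong (λ x → expand (χ (D? (g ∙ x))) (χ (D? x))) ⟩
    ∑ (λ x → 1ℤ +ᶻ (- (+ 2) *ᶻ (χ (D? (g ∙ x)) +ᶻ χ (D? x)) +ᶻ + 4 *ᶻ (χ (D? (g ∙ x)) *ᶻ χ (D? x))))
      ≡⟨ ∑-linear (- (+ 2)) (+ 4) (λ _ → 1ℤ) (λ x → χ (D? (g ∙ x)) +ᶻ χ (D? x))
           (λ x → χ (D? (g ∙ x)) *ᶻ χ (D? x)) ⟩
    ∑ (λ _ → 1ℤ) +ᶻ (- (+ 2) *ᶻ ∑ (λ x → χ (D? (g ∙ x)) +ᶻ χ (D? x)) +ᶻ
                     + 4 *ᶻ ∑ (λ x → χ (D? (g ∙ x)) *ᶻ χ (D? x)))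
      ≡⟨ cong₂ _+ᶻ_ (trans (∑-const 1ℤ) (ℤ.*-identityʳ (+ v)))
           (cong₂ (λ i j → - (+ 2) *ᶻ i +ᶻ + 4 *ᶻ j) 2k (∑χχ g≉ε)) ⟩
    + v +ᶻ (- (+ 2) *ᶻ (+ k +ᶻ + k) +ᶻ + 4 *ᶻ + λ′)
      ≡⟨ double (+ v) (+ k) (+ λ′) ⟩
    + v +ᶻ (- (+ 4) *ᶻ + k +ᶻ + 4 *ᶻ + λ′) ∎
    where
    expand : ∀ i j → (-[1+ 0 ] +ᶻ + 2 *ᶻ i) *ᶻ (-[1+ 0 ] +ᶻ + 2 *ᶻ j) ≡
                     1ℤ +ᶻ (- (+ 2) *ᶻ (i +ᶻ j) +ᶻ + 4 *ᶻ (i *ᶻ j))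
    expand = solve-∀
    double : ∀ v k l → v +ᶻ (- (+ 2) *ᶻ (k +ᶻ k) +ᶻ + 4 *ᶻ l) ≡ v +ᶻ (- (+ 4) *ᶻ k +ᶻ + 4 *ᶻ l)
    double = solve-∀
    ∑χ : ∑ (χ ∘ D?) ≡ + k
    ∑χ = cardinality⇒∑χ respects D? size
    2k : ∑ (λ x → χ (D? (g ∙ x)) +ᶻ χ (D? x)) ≡ + k +ᶻ + k
    2k = trans (∑-+ (λ x → χ (D? (g ∙ x))) (χ ∘ D?)) (cong₂ _+ᶻ_
      (trans (∑-reindex (leftTranslation g) λ {x} {y} x≈y →
        χ-cong (D? x) (D? y) (respects x≈y) (respects (G.sym x≈y))) ∑χ) ∑χ)

  -- Indicators of the three sets, and their compatibility with equality.

  P₁? : Decidable (D ² ∪ (∁ D) ²)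
  P₁? (x , y) = (D? x ×-dec D? y) ⊎-dec (¬? (D? x) ×-dec ¬? (D? y))

  P₂? : Decidable (offDiagonalSquare G D ∪ offDiagonalSquare G (∁ D))
  P₂? (x , y) =
    ((D? x ×-dec D? y) ×-dec ¬? (D? x ×-dec x ≟ y)) ⊎-dec
    ((¬? (D? x) ×-dec ¬? (D? y)) ×-dec ¬? (¬? (D? x) ×-dec x ≟ y))

  P₃? : Decidable ((D ⟨×⟩ ∁ D) ∪ (∁ D ⟨×⟩ D))
  P₃? (x , y) = (D? x ×-dec ¬? (D? y)) ⊎-dec (¬? (D? x) ×-dec D? y)

  χP₁ : ∀ x y → + 2 *ᶻ χ (P₁? (x , y)) ≡ 1ℤ +ᶻ (1ℤ *ᶻ (sign x *ᶻ sign y) +ᶻ 0ℤ *ᶻ δ x y)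
  χP₁ x y with D? x | D? y
  ... | yes _ | yes _ = refl
  ... | yes _ | no  _ = refl
  ... | no  _ | yes _ = refl
  ... | no  _ | no  _ = refl

  -- On the diagonal the signs agree and the first two terms add up to 2, which the coefficient -2
  -- removes. Equal elements cannot lie on different sides of `D`.
  χP₂ : ∀ x y → + 2 *ᶻ χ (P₂? (x , y)) ≡ 1ℤ +ᶻ (1ℤ *ᶻ (sign x *ᶻ sign y) +ᶻ - (+ 2) *ᶻ δ x y)
  χP₂ x y with D? x | D? y | x ≟ y
  ... | yes _   | yes _   | yes _   = refl
  ... | yes _   | yes _   | no  _   = refl
  ... | yes x∈D | no y∉D  | yes x≈y = contradiction (respects x≈y x∈D) y∉D
  ... | yes _   | no  _   | no  _   = refl
  ... | no x∉D  | yes y∈D | yes x≈y = contradiction (respects (G.sym x≈y) y∈D) x∉D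
  ... | no  _   | yes _   | no  _   = refl
  ... | no  _   | no  _   | yes _   = refl
  ... | no  _   | no  _   | no  _   = refl

  -- Opposite signs multiply to -1, hence the coefficient -1; the diagonal is excluded already and
  -- takes no correction.
  χP₃ : ∀ x y → + 2 *ᶻ χ (P₃? (x , y)) ≡
                1ℤ +ᶻ (-[1+ 0 ] *ᶻ (sign x *ᶻ sign y) +ᶻ 0ℤ *ᶻ δ x y)
  χP₃ x y with D? x | D? y
  ... | yes _ | yes _ = refl
  ... | yes _ | no  _ = refl
  ... | no  _ | yes _ = refl
  ... | no  _ | no  _ = refl

  private
    _≈²_ = Setoid._≈_ (setoid ×ₛ setoid)

  ⟨×⟩-respects : ∀ {q r} {E : Pred Carrier q} {F : Pred Carrier r} →
    E Respects _≈_ → F Respects _≈_ → (E ⟨×⟩ F) Respects _≈²_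
  ⟨×⟩-respects E-resp F-resp (p , q) (x∈E , y∈F) = E-resp p x∈E , F-resp q y∈F

  offDiagonalSquare-respects : ∀ {q} {E : Pred Carrier q} →
    E Respects _≈_ → offDiagonalSquare G E Respects _≈²_
  offDiagonalSquare-respects E-resp (p , q) ((x∈E , y∈E) , off) =
    (E-resp p x∈E , E-resp q y∈E) ,
    λ (_ , x′≈y′) → off (x∈E , G.trans p (G.trans x′≈y′ (G.sym q)))

  ∪-respects : ∀ {q r} {P : Pred (Carrier × Carrier) q} {Q : Pred (Carrier × Carrier) r} →
    P Respects _≈²_ → Q Respects _≈²_ → (P ∪ Q) Respects _≈²_
  ∪-respects P-resp Q-resp eq = Sum.map (P-resp eq) (Q-resp eq)

theorem3p14 : ∀ {c ℓ p} (n : ℕ) → 2 ≤ n →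
    (G : Group c ℓ) → HasCardinality (Group.setoid G) (4 * n ^ 2) →
    (D : Pred (Group.Carrier G) p) → IsHadamardDifferenceSet G n D →
    IsDifferenceSetOfPropriety3 G
    (4 * n ^ 2) (2 * n ^ 2 * (4 * n ^ 2 + 1)) (2 * n ^ 2 * (2 * n ^ 2 + 1))
    (D ² ∪ (∁ D) ²)
    × IsDifferenceSetOfPropriety3 G
    (4 * n ^ 2) (2 * n ^ 2 * (4 * n ^ 2 ∸ 1)) (2 * n ^ 2 * (2 * n ^ 2 ∸ 1))
    (offDiagonalSquare G D ∪ offDiagonalSquare G (∁ D))
    × IsDifferenceSetOfPropriety3 G
    (4 * n ^ 2) (2 * n ^ 2 * (4 * n ^ 2 ∸ 1)) (2 * n ^ 2 * (2 * n ^ 2 ∸ 1))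
    ((D ⟨×⟩ ∁ D) ∪ (∁ D ⟨×⟩ D))
-- The clause for zero is absent because 2 ≤ 0 is empty. Exposing `suc` also makes `n ^ 1` visibly
-- nonzero, as `n≤n²` requires.
theorem3p14 n@(suc _) _ G finite D hadamard =
    Weight.propriety3 1ℤ 0ℤ refl
      (∪-respects (⟨×⟩-respects respects respects) (⟨×⟩-respects ∁D-respects ∁D-respects))
      P₁? χP₁ K⁺ Λ⁺
  -- With s = 1 and c = -2, `relation` computes to 4 = 4.
  , Weight.propriety3 1ℤ (- (+ 2)) refl
      (∪-respects (offDiagonalSquare-respects respects) (offDiagonalSquare-respects ∁D-respects))
      P₂? χP₂ 
      (trans K⁻ (cong (N *ᶻ N +ᶻ_) (1-2≡-1 N)))
      (trans Λ⁻ (cong (λ i → N *ᶻ N +ᶻ + 2 *ᶻ i) (1-2≡-1 N)))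
  , Weight.propriety3 -[1+ 0 ] 0ℤ refl
      (∪-respects (⟨×⟩-respects respects ∁D-respects) (⟨×⟩-respects ∁D-respects respects))
      P₃? χP₃ K⁻ Λ⁻
  where
  open ≡-Reasoning
  open IsDifferenceSet hadamard using (respects)
  open DifferenceSet G finite D hadamard
  open FiniteGroup G finite using (∑; module Autocorrelation)
  open Autocorrelation sign sign-cong using (leftCorrelation)
  open Group G using (_≈_; ε)

  -- Arithmetic of the Hadamard parameters.

  m n² N : ℤ
  m  = + n
  n² = + (n ^ 2)
  N  = + (4 * n ^ 2)

  n²≡m*m : n² ≡ m *ᶻ m
  n²≡m*m = trans (cong +_ (cong (n *_) (ℕ.*-identityʳ n))) (ℤ.pos-* n n)

  n≤n² : n ≤ n ^ 2
  n≤n² = ℕ.m≤m*n n (n ^ 1)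

  1≤n² : 1 ≤ n ^ 2
  1≤n² = ℕ.≤-trans (s≤s z≤n) n≤n²

  -- Truncated subtraction is genuine subtraction only under this inequality; the bounds `n≤n²` and
  -- `1≤n²` provide it for every parameter.
  pos-∸ : ∀ {i j} → j ≤ i → + (i ∸ j) ≡ + i +ᶻ - (+ j)
  pos-∸ {i} {j} j≤i = sym (trans (ℤ.m-n≡m⊖n i j) (ℤ.⊖-≥ j≤i))

  N≡4n² : N ≡ + 4 *ᶻ n²
  N≡4n² = ℤ.pos-* 4 (n ^ 2)

  2n²≡ : + (2 * n ^ 2) ≡ + 2 *ᶻ n²
  2n²≡ = ℤ.pos-* 2 (n ^ 2)

  k≡ : + (2 * n ^ 2 ∸ n) ≡ + 2 *ᶻ n² +ᶻ - m
  k≡ = trans (pos-∸ (ℕ.≤-trans n≤n² (ℕ.m≤n*m (n ^ 2) 2))) (cong (_+ᶻ - m) 2n²≡)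

  λ≡ : + (n ^ 2 ∸ n) ≡ n² +ᶻ - m
  λ≡ = pos-∸ n≤n²

  2n²*_ : ∀ {i j} → + i ≡ j → + (2 * n ^ 2 * i) ≡ (+ 2 *ᶻ n²) *ᶻ j
  2n²*_ {i} eq = trans (ℤ.pos-* (2 * n ^ 2) i) (cong₂ _*ᶻ_ 2n²≡ eq)

  -- The sum is -4n² + 2(2n² - n) = -2n.
  ∑sign-squared : ∑ sign *ᶻ ∑ sign ≡ N
  ∑sign-squared = begin
    ∑ sign *ᶻ ∑ sign
      ≡⟨ cong (λ i → i *ᶻ i) (trans ∑sign (cong₂ (λ i j → - i +ᶻ + 2 *ᶻ j) N≡4n² k≡)) ⟩
    (- (+ 4 *ᶻ n²) +ᶻ + 2 *ᶻ (+ 2 *ᶻ n² +ᶻ - m)) *ᶻ (- (+ 4 *ᶻ n²) +ᶻ + 2 *ᶻ (+ 2 *ᶻ n² +ᶻ - m))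
      ≡⟨ simplify n² m ⟩
    + 4 *ᶻ (m *ᶻ m)
      ≡⟨ cong (+ 4 *ᶻ_) n²≡m*m ⟨
    + 4 *ᶻ n²
      ≡⟨ N≡4n² ⟨
    N ∎
    where
    simplify : ∀ a m → (- (+ 4 *ᶻ a) +ᶻ + 2 *ᶻ (+ 2 *ᶻ a +ᶻ - m)) *ᶻ
                       (- (+ 4 *ᶻ a) +ᶻ + 2 *ᶻ (+ 2 *ᶻ a +ᶻ - m)) ≡ + 4 *ᶻ (m *ᶻ m)
    simplify = solve-∀

  -- The value v - 4k + 4λ is 4n² - 4(2n² - n) + 4(n² - n).
  leftCorrelation≡0 : ∀ {g} → ¬ g ≈ ε → leftCorrelation g ≡ 0ℤ
  leftCorrelation≡0 g≉ε = trans (leftCorrelation-sign g≉ε)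
    (trans (cong₂ _+ᶻ_ N≡4n² (cong₂ (λ i j → - (+ 4) *ᶻ i +ᶻ + 4 *ᶻ j) k≡ λ≡)) (simplify n² m))
    where
    simplify : ∀ a m → + 4 *ᶻ a +ᶻ (- (+ 4) *ᶻ (+ 2 *ᶻ a +ᶻ - m) +ᶻ + 4 *ᶻ (a +ᶻ - m)) ≡ 0ℤ
    simplify = solve-∀

  open HadamardFunction G finite sign sign-cong sign² leftCorrelation≡0 ∑sign-squared

  ∸1 : ∀ i → 1 ≤ i → + (i * n ^ 2 ∸ 1) ≡ + i *ᶻ n² +ᶻ -[1+ 0 ]
  ∸1 i 1≤i = trans (pos-∸ (ℕ.*-mono-≤ 1≤i 1≤n²)) (cong (_+ᶻ -[1+ 0 ]) (ℤ.pos-* i (n ^ 2)))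

  -- With a = n² and N = 4 a, both sides are 16 a² + 4 a; for `Λ⁺` they are 16 a² + 8 a.
  K⁺ : + 2 *ᶻ + (2 * n ^ 2 * (4 * n ^ 2 + 1)) ≡ N *ᶻ N +ᶻ (1ℤ *ᶻ N +ᶻ 0ℤ *ᶻ N)
  K⁺ = trans (cong (+ 2 *ᶻ_) (2n²* cong (_+ᶻ 1ℤ) N≡4n²))
    (trans (identity n²) (cong (λ N → N *ᶻ N +ᶻ (1ℤ *ᶻ N +ᶻ 0ℤ *ᶻ N)) (sym N≡4n²)))
    where
    identity : ∀ a → + 2 *ᶻ ((+ 2 *ᶻ a) *ᶻ (+ 4 *ᶻ a +ᶻ 1ℤ)) ≡
      (+ 4 *ᶻ a) *ᶻ (+ 4 *ᶻ a) +ᶻ (1ℤ *ᶻ (+ 4 *ᶻ a) +ᶻ 0ℤ *ᶻ (+ 4 *ᶻ a))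
    identity = solve-∀

  Λ⁺ : + 4 *ᶻ + (2 * n ^ 2 * (2 * n ^ 2 + 1)) ≡ N *ᶻ N +ᶻ + 2 *ᶻ (1ℤ *ᶻ N +ᶻ 0ℤ *ᶻ N)
  Λ⁺ = trans (cong (+ 4 *ᶻ_) (2n²* cong (_+ᶻ 1ℤ) 2n²≡))
    (trans (identity n²) (cong (λ N → N *ᶻ N +ᶻ + 2 *ᶻ (1ℤ *ᶻ N +ᶻ 0ℤ *ᶻ N)) (sym N≡4n²)))
    where
    identity : ∀ a → + 4 *ᶻ ((+ 2 *ᶻ a) *ᶻ (+ 2 *ᶻ a +ᶻ 1ℤ)) ≡
      (+ 4 *ᶻ a) *ᶻ (+ 4 *ᶻ a) +ᶻ + 2 *ᶻ (1ℤ *ᶻ (+ 4 *ᶻ a) +ᶻ 0ℤ *ᶻ (+ 4 *ᶻ a))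
    identity = solve-∀

  -- Both sides are 16 a² - 4 a, and 16 a² - 8 a for `Λ⁻`; `∸1` first replaces the truncated
  -- subtraction.
  K⁻ : + 2 *ᶻ + (2 * n ^ 2 * (4 * n ^ 2 ∸ 1)) ≡ N *ᶻ N +ᶻ (-[1+ 0 ] *ᶻ N +ᶻ 0ℤ *ᶻ N)
  K⁻ = trans (cong (+ 2 *ᶻ_) (2n²* ∸1 4 (s≤s z≤n)))
    (trans (identity n²) (cong (λ N → N *ᶻ N +ᶻ (-[1+ 0 ] *ᶻ N +ᶻ 0ℤ *ᶻ N)) (sym N≡4n²)))
    where
    identity : ∀ a → + 2 *ᶻ ((+ 2 *ᶻ a) *ᶻ (+ 4 *ᶻ a +ᶻ -[1+ 0 ])) ≡
      (+ 4 *ᶻ a) *ᶻ (+ 4 *ᶻ a) +ᶻ (-[1+ 0 ] *ᶻ (+ 4 *ᶻ a) +ᶻ 0ℤ *ᶻ (+ 4 *ᶻ a))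
    identity = solve-∀

  Λ⁻ : + 4 *ᶻ + (2 * n ^ 2 * (2 * n ^ 2 ∸ 1)) ≡ N *ᶻ N +ᶻ + 2 *ᶻ (-[1+ 0 ] *ᶻ N +ᶻ 0ℤ *ᶻ N)
  Λ⁻ = trans (cong (+ 4 *ᶻ_) (2n²* ∸1 2 (s≤s z≤n)))
    (trans (identity n²) (cong (λ N → N *ᶻ N +ᶻ + 2 *ᶻ (-[1+ 0 ] *ᶻ N +ᶻ 0ℤ *ᶻ N)) (sym N≡4n²)))
    where
    identity : ∀ a → + 4 *ᶻ ((+ 2 *ᶻ a) *ᶻ (+ 2 *ᶻ a +ᶻ -[1+ 0 ])) ≡
      (+ 4 *ᶻ a) *ᶻ (+ 4 *ᶻ a) +ᶻ + 2 *ᶻ (-[1+ 0 ] *ᶻ (+ 4 *ᶻ a) +ᶻ 0ℤ *ᶻ (+ 4 *ᶻ a))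
    identity = solve-∀

  -- K and Λ depend on (s , c) only through s + c.
  1-2≡-1 : ∀ N → -[1+ 0 ] *ᶻ N +ᶻ 0ℤ *ᶻ N ≡ 1ℤ *ᶻ N +ᶻ - (+ 2) *ᶻ N
  1-2≡-1 = solve-∀
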